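{- For integers $r\ge1$ and $n\ge 0$ let $C_n^{(r)}=\frac{r}{2n+r}\binom{2n+r}{n}$. Then for every integer $k\ge 1$ $$\det\bigl(C_{i+j}^{(2k+1)}\bigr)_{i,j=0}^{k}=0.$$
   Context: The numbers $C_n^{(r)}$ are the convolution powers of the Catalan numbers $C_n=\frac1{n+1}\binom{2n}{n}$: $\sum_{n\ge0}C_n^{(r)}z^n=\bigl(\sum_{n\ge0}C_nz^n\bigr)^r$. The matrix in the claim has size $(k+1)\times(k+1)$. -}

module Defs where

open import Algebra.Bundles using (CommutativeRing)
open import Data.Fin.Base as Fin using (Fin; toℕ; punchIn)
open import Data.Integer.Base using (+_)
open import Data.Nat.Base using (ℕ; zero; suc; _+_; _*_; NonZero)
open import Data.Nat.Combinatorics using (_C_)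
open import Data.Rational.Base as ℚ using (ℚ; _/_)
open import Data.Rational.Properties using (+-*-commutativeRing)

import Algebra.Properties.Semiring.Exp as Exp
import Algebra.Properties.Semiring.Sum as Sum

module Matrices {c ℓ} (R : CommutativeRing c ℓ) where
  open CommutativeRing R
    using (Carrier; semiring; 1#)
    renaming (_*_ to _·_; -_ to neg)
  open Exp semiring using (_^_)
  open Sum semiring using (sum)

  Matrix : ℕ → ℕ → Set c
  Matrix m n = Fin m → Fin n → Carrier

  -- Row i and column j deleted: punchIn i skips the value i.
  minor : ∀ {m n} → Fin (suc m) → Fin (suc n) →
          Matrix (suc m) (suc n) → Matrix m n
  minor i j A p q = A (punchIn i p) (punchIn j q)

  -- Laplace expansion along the first row:
  -- det A = Σⱼ (-1)ʲ A₀ⱼ det (A with row 0 and column j deleted).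
  det : ∀ n → Matrix n n → Carrier
  det zero    A = 1#
  det (suc n) A =
    sum λ j → (neg 1# ^ toℕ j) · (A Fin.zero j · det n (minor Fin.zero j A))

open Matrices +-*-commutativeRing public

2n+r≢0 : ∀ n r .{{_ : NonZero r}} → NonZero (2 * n + r)
2n+r≢0 zero    (suc r) = _
2n+r≢0 (suc n) (suc r) = _

-- These numbers are integers, but the formula divides, so they are taken in ℚ.
catalan : (r : ℕ) .{{_ : NonZero r}} → ℕ → ℚ
catalan r n =
  (_/_ (+ r) (2 * n + r) {{2n+r≢0 n r}}) ℚ.* (+ ((2 * n + r) C n) / 1)

{-# OPTIONS --safe #-}

-- The matrix has a kernel vector without zero entries. Let C = 1 + t be the
-- Catalan series, so x = t/(1+t)². The polynomial P of degree k with
-- P(1/x) = (t⁻ᵏ + tᵏ⁺¹)/(1+t) satisfies P(1/x) C²ᵏ⁺¹ = x⁻ᵏ + xᵏ⁺¹ C⁴ᵏ⁺², whose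
-- coefficients at x⁰, …, xᵏ vanish; these are the entries of the matrix applied to
-- the coefficient vector of P. Up to alternating signs these coefficients are
-- positive, being those of a Lucas polynomial.
-- After scaling the columns by them all row sums are zero. Such a matrix has
-- determinant zero: by induction all its first-row cofactors coincide.
module Submission where

open import Defs
open import Algebra.Bundles using (CommutativeRing)
open import Data.Fin.Base as Fin using (Fin; zero; suc; toℕ; punchIn; punchOut; inject₁)
open import Data.Fin.Induction using (<-weakInduction)
open import Data.Fin.Properties as Fin using (_≟_; punchIn-punchOut; punchInᵢ≢i; toℕ-inject₁)
import Data.Integer.Base as ℤ
import Data.Integer.Properties as ℤ
open import Data.Nat.Base using (ℕ; suc; _+_; _*_; _∸_; _≤_; _<_; z≤n; s≤s; NonZero)
open import Data.Nat.Combinatorics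
  using (_C_; nC1≡n; k>n⇒nCk≡0; nCk≡nC[n∸k]; nCk+nC[k+1]≡[n+1]C[k+1])
import Data.Nat.Properties as ℕₚ
open import Data.Nat.Properties
  using (≤-refl; ≤-reflexive; ≤-trans; <-trans; n<1+n; m≤m+n; m≤n+m; m+n∸m≡n;
         m≤n⇒m≤1+n; m≤n⇒m<n∨m≡n; +-suc; +-cancelʳ-≡)
open import Data.Nat.Solver using (module +-*-Solver)
open import Data.Sum.Base using (inj₁; inj₂)
open import Data.Rational.Base as ℚ using (ℚ; 0ℚ)
import Data.Rational.Properties as ℚₚ
import Data.Rational.Unnormalised.Base as ℚᵘ
import Data.Rational.Unnormalised.Properties as ℚᵘₚ
open import Data.Vec.Functional using (Vector; removeAt; updateAt)
open import Data.Vec.Functional.Properties using (updateAt-updates; updateAt-minimal)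
open import Function.Base using (_∘_)
open import Relation.Binary.PropositionalEquality as ≡ using (_≡_; _≢_; module ≡-Reasoning)
open import Relation.Nullary using (yes; no; contradiction)

import Algebra.Properties.CommutativeMonoid.Sum as CMSum
import Algebra.Properties.Semiring.Mult as Mult
import Algebra.Properties.Ring as RingProperties
import Algebra.Properties.Semiring.Exp as Exp
import Algebra.Properties.Semiring.Sum as Sum
import Relation.Binary.Reasoning.Setoid as SetoidReasoning
import Algebra.Solver.Ring.NaturalCoefficients.Default as Solver

-- Deleting neighbouring indices

punchIn-suc-self : ∀ {n} (p : Fin n) → punchIn (suc p) p ≡ inject₁ p
punchIn-suc-self zero    = ≡.refl
punchIn-suc-self (suc p) = ≡.cong suc (punchIn-suc-self p)

punchIn-inject₁-self : ∀ {n} (p : Fin n) → punchIn (inject₁ p) p ≡ suc p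
punchIn-inject₁-self zero    = ≡.refl
punchIn-inject₁-self (suc p) = ≡.cong suc (punchIn-inject₁-self p)

-- Together with the two preceding facts: deleting column p + 1 and deleting column p leave families
-- that differ only at position p, where they hold column p and column p + 1 respectively.
punchIn-suc≡punchIn-inject₁ : ∀ {n} {p q : Fin n} → q ≢ p →
                              punchIn (suc p) q ≡ punchIn (inject₁ p) q
punchIn-suc≡punchIn-inject₁ {p = zero}  {zero}  q≢p = contradiction ≡.refl q≢p
punchIn-suc≡punchIn-inject₁ {p = zero}  {suc q} q≢p = ≡.refl
punchIn-suc≡punchIn-inject₁ {p = suc p} {zero}  q≢p = ≡.refl
punchIn-suc≡punchIn-inject₁ {p = suc p} {suc q} q≢p =
  ≡.cong suc (punchIn-suc≡punchIn-inject₁ (q≢p ∘ ≡.cong suc))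

-- Powers of the Catalan series and their closed formula

-- conv s n is the coefficient of xⁿ in C(x)ˢ, where C = 1 + x C²; multiplying
-- by Cˢ gives the recursion Cˢ⁺¹ = Cˢ + x Cˢ⁺².
conv : ℕ → ℕ → ℕ
conv s       ℕ.zero  = 1
conv ℕ.zero  (suc n) = 0
conv (suc s) (suc n) = conv s (suc n) + conv (suc (suc s)) n

-- The coefficient of xⁿ in xᵐ C(x)ˢ.
shiftedConv : ℕ → ℕ → ℕ → ℕ
shiftedConv ℕ.zero  s n       = conv s n
shiftedConv (suc m) s ℕ.zero  = 0
shiftedConv (suc m) s (suc n) = shiftedConv m s n

-- The identity Cˢ⁺¹ = Cˢ + x Cˢ⁺² times xᵐ. Every case reduces to the recursion of `conv`.
shiftedConv-pascal : ∀ m s n →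
  shiftedConv m (suc s) n ≡ shiftedConv m s n + shiftedConv (suc m) (suc (suc s)) n
shiftedConv-pascal ℕ.zero  s ℕ.zero  = ≡.refl
shiftedConv-pascal ℕ.zero  s (suc n) = ≡.refl
shiftedConv-pascal (suc m) s ℕ.zero  = ≡.refl
shiftedConv-pascal (suc m) s (suc n) = shiftedConv-pascal m s n

shiftedConv≡0 : ∀ {m n} s → n < m → shiftedConv m s n ≡ 0
shiftedConv≡0 {suc m} {ℕ.zero} s n<m       = ≡.refl
shiftedConv≡0 {suc m} {suc n}  s (s≤s n<m) = shiftedConv≡0 s n<m

-- Absorption, by induction with Pascal's rule. The spare copy of `b` split off on the left raises
-- the factor `suc n` to `suc (suc n)`.
[1+k]*[1+n]C[1+k]≡[1+n]*nCk : ∀ n k → suc k * (suc n C suc k) ≡ suc n * (n C k)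
[1+k]*[1+n]C[1+k]≡[1+n]*nCk n ℕ.zero = begin
  1 * (suc n C 1)   ≡⟨ ℕₚ.*-identityˡ (suc n C 1) ⟩
  suc n C 1         ≡⟨ nC1≡n (suc n) ⟩
  suc n             ≡⟨ ℕₚ.*-identityʳ (suc n) ⟨
  suc n * 1         ∎
  where open ≡-Reasoning
[1+k]*[1+n]C[1+k]≡[1+n]*nCk ℕ.zero (suc k) = begin
  suc (suc k) * (1 C suc (suc k))   ≡⟨ ≡.cong (suc (suc k) *_) (k>n⇒nCk≡0 (s≤s (s≤s (z≤n {k})))) ⟩
  suc (suc k) * 0                   ≡⟨ ℕₚ.*-zeroʳ (suc (suc k)) ⟩
  0                                 ∎
  where open ≡-Reasoning
[1+k]*[1+n]C[1+k]≡[1+n]*nCk (suc n) (suc k) = begin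
  suc (suc k) * (suc (suc n) C suc (suc k))
    ≡⟨ ≡.cong (suc (suc k) *_) (nCk+nC[k+1]≡[n+1]C[k+1] (suc n) (suc k)) ⟨
  suc (suc k) * (b + (suc n C suc (suc k)))
    ≡⟨ solve 3 (λ k b c → (con 2 :+ k) :* (b :+ c) :=
                          b :+ ((con 1 :+ k) :* b :+ (con 2 :+ k) :* c)) ≡.refl k b _ ⟩
  b + (suc k * b + suc (suc k) * (suc n C suc (suc k)))
    ≡⟨ ≡.cong (b +_) (≡.cong₂ _+_ ([1+k]*[1+n]C[1+k]≡[1+n]*nCk n k)
                                  ([1+k]*[1+n]C[1+k]≡[1+n]*nCk n (suc k))) ⟩
  b + (suc n * (n C k) + suc n * (n C suc k))
    ≡⟨ ≡.cong (b +_) (ℕₚ.*-distribˡ-+ (suc n) (n C k) (n C suc k)) ⟨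
  b + suc n * (n C k + n C suc k)
    ≡⟨ ≡.cong (λ x → b + suc n * x) (nCk+nC[k+1]≡[n+1]C[k+1] n k) ⟩
  b + suc n * b ∎
  where
  open ≡-Reasoning
  open +-*-Solver
  b = suc n C suc k

-- The difference form avoids the division in the closed formula, so that only
-- Pascal's rule is needed.
conv-binomial : ∀ n s →
  conv s (suc n) + suc (n * 2 + s) C n ≡ suc (n * 2 + s) C suc n
conv-binomial n ℕ.zero = begin
  -- Here `conv 0 (suc n)` is 0 and `m` is 2n + 1, so the claim is the equality of the two middle
  -- binomials of an odd row.
  m C n               ≡⟨ nCk≡nC[n∸k] (≤-trans (m≤m+n n (suc n)) (≤-reflexive (≡.sym m≡))) ⟩
  m C (m ∸ n)         ≡⟨ ≡.cong (λ x → m C (x ∸ n)) m≡ ⟩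
  m C (n + suc n ∸ n) ≡⟨ ≡.cong (m C_) (m+n∸m≡n n (suc n)) ⟩
  m C suc n           ∎
  where
  open ≡-Reasoning
  open +-*-Solver
  m = suc (n * 2 + 0)
  m≡ : m ≡ n + suc n
  m≡ = solve 1 (λ n → con 1 :+ (n :* con 2 :+ con 0) := n :+ (con 1 :+ n)) ≡.refl n
conv-binomial ℕ.zero (suc s) = begin
  conv s 1 + 1 + 1        ≡⟨ ≡.cong (_+ 1) (conv-binomial 0 s) ⟩
  suc s C 1 + 1           ≡⟨ ≡.cong (_+ 1) (nC1≡n (suc s)) ⟩
  suc s + 1               ≡⟨ ℕₚ.+-comm (suc s) 1 ⟩
  suc (suc s)             ≡⟨ nC1≡n (suc (suc s)) ⟨
  suc (suc s) C 1         ∎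
  where open ≡-Reasoning
conv-binomial (suc n) (suc s) = begin
  conv s (suc (suc n)) + conv (suc (suc s)) (suc n) + suc (suc n * 2 + suc s) C suc n
    ≡⟨ ≡.cong (λ x → conv s (suc (suc n)) + conv (suc (suc s)) (suc n) + suc x C suc n)
         (+-suc (suc n * 2) s) ⟩
  conv s (suc (suc n)) + conv (suc (suc s)) (suc n) + suc m C suc n
    ≡⟨ ≡.cong (conv s (suc (suc n)) + conv (suc (suc s)) (suc n) +_)
         (nCk+nC[k+1]≡[n+1]C[k+1] m n) ⟨
  conv s (suc (suc n)) + conv (suc (suc s)) (suc n) + (m C n + m C suc n)
    ≡⟨ solve 4 (λ a b c d → a :+ b :+ (c :+ d) := (b :+ c) :+ (a :+ d))
         ≡.refl (conv s (suc (suc n))) (conv (suc (suc s)) (suc n)) (m C n) (m C suc n) ⟩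
  (conv (suc (suc s)) (suc n) + m C n) + (conv s (suc (suc n)) + m C suc n)
    ≡⟨ ≡.cong₂ _+_ shorter (conv-binomial (suc n) s) ⟩
  m C suc n + m C suc (suc n)
    ≡⟨ nCk+nC[k+1]≡[n+1]C[k+1] m (suc n) ⟩
  suc m C suc (suc n)
    ≡⟨ ≡.cong (λ x → suc x C suc (suc n)) (+-suc (suc n * 2) s) ⟨
  suc (suc n * 2 + suc s) C suc (suc n) ∎
  where
  open ≡-Reasoning
  open +-*-Solver
  m = suc (suc n * 2 + s)
  -- Lowering n by one and raising s by two keeps the row 2n + s + 1, so both induction hypotheses
  -- speak of the same `m`.
  shorter : conv (suc (suc s)) (suc n) + m C n ≡ m C suc n
  shorter = ≡.subst (λ x → conv (suc (suc s)) (suc n) + suc x C n ≡ suc x C suc n)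
    (≡.trans (+-suc (n * 2) (suc s)) (≡.cong suc (+-suc (n * 2) s)))
    (conv-binomial n (suc (suc s)))

-- Absorption turns the difference of neighbouring binomials into the closed formula. Adding 2(n +
-- 1)`B` to both sides replaces the subtraction.
conv-formula : ∀ n s → (2 * n + s) * conv s n ≡ s * ((2 * n + s) C n)
conv-formula ℕ.zero  s = ≡.refl
conv-formula (suc n) s = +-cancelʳ-≡ (2 * (suc n * B)) _ _ (begin
  (2 * suc n + s) * c + 2 * (suc n * B)
    ≡⟨ ≡.cong₂ (λ x y → x * c + 2 * y) 2n+s≡ absorb ⟩
  suc m * c + 2 * (suc m * (m C n))
    ≡⟨ solve 3 (λ m c d → m :* c :+ con 2 :* (m :* d) := m :* (d :+ (c :+ d)))
         ≡.refl (suc m) c (m C n) ⟩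
  suc m * (m C n + (c + m C n))
    ≡⟨ ≡.cong (λ x → suc m * (m C n + x)) (conv-binomial n s) ⟩
  suc m * (m C n + m C suc n)
    ≡⟨ ≡.cong (suc m *_) (nCk+nC[k+1]≡[n+1]C[k+1] m n) ⟩
  suc m * (suc m C suc n)
    ≡⟨ ≡.cong (λ x → x * (x C suc n)) 2n+s≡ ⟨
  (2 * suc n + s) * B
    ≡⟨ solve 3 (λ n s b → (con 2 :* (con 1 :+ n) :+ s) :* b :=
                          s :* b :+ con 2 :* ((con 1 :+ n) :* b)) ≡.refl n s B ⟩
  s * B + 2 * (suc n * B) ∎)
  where
  open ≡-Reasoning
  open +-*-Solver
  m = suc (n * 2 + s)
  c = conv s (suc n)
  B = (2 * suc n + s) C suc n
  2n+s≡ : 2 * suc n + s ≡ suc m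
  2n+s≡ = ≡.cong (_+ s) (ℕₚ.*-comm 2 (suc n))
  absorb : suc n * B ≡ suc m * (m C n)
  absorb = ≡.trans (≡.cong (λ x → suc n * (x C suc n)) 2n+s≡)
                   ([1+k]*[1+n]C[1+k]≡[1+n]*nCk m n)

-- Lucas polynomials and their values

-- Coefficients of polynomials in y that are the Lucas numbers L₂ₖ and L₂ₖ₊₁ at y = 1;
-- the factor y enters only in L₂ₖ₊₂ = y L₂ₖ₊₁ + L₂ₖ.
mutual
  evenLucas : ℕ → ℕ → ℕ
  evenLucas ℕ.zero  ℕ.zero  = 2
  evenLucas ℕ.zero  (suc j) = 0
  evenLucas (suc k) ℕ.zero  = evenLucas k 0
  evenLucas (suc k) (suc j) = oddLucas k j + evenLucas k (suc j)

  oddLucas : ℕ → ℕ → ℕ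
  oddLucas ℕ.zero  ℕ.zero  = 1
  oddLucas ℕ.zero  (suc j) = 0
  oddLucas (suc k) j       = oddLucas k j + evenLucas (suc k) j

oddLucas-positive : ∀ {k j} → j ≤ k → 1 ≤ oddLucas k j
oddLucas-positive {ℕ.zero} {ℕ.zero} j≤k = s≤s z≤n
oddLucas-positive {suc k} {j} j≤1+k with m≤n⇒m<n∨m≡n j≤1+k
... | inj₁ (s≤s j≤k) = ≤-trans (oddLucas-positive j≤k) (m≤m+n (oddLucas k j) _)
-- The leading coefficient comes from `oddLucas k k` through the factor y in the even recursion.
... | inj₂ ≡.refl    = ≤-trans (oddLucas-positive (≤-refl {k}))
                         (≤-trans (m≤m+n (oddLucas k k) _) (m≤n+m _ (oddLucas k (suc k))))

-- Put x = t/(1+t)², so that C(x) = 1 + t. At y = −1/x the Lucas polynomials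
-- become L₂ₖ = (−1)ᵏ (tᵏ + t⁻ᵏ) and L₂ₖ₊₁ = (−1)ᵏ (t⁻ᵏ + tᵏ⁺¹) / (1 + t); multiply
-- by C²ᴷ⁺¹ and use t = x C². The values below are the coefficients at xⁿ, for
-- e = K − k and without the sign (−1)ᵏ.
module LucasValues (K : ℕ) where
  f : ℕ → ℕ
  f = conv (suc (K * 2))

  evenValue oddValue : ℕ → ℕ → ℕ → ℕ
  evenValue k e n = shiftedConv k (suc (k * 2 + K * 2)) n + conv (suc (e * 2)) (k + n)
  oddValue  k e n = shiftedConv (suc k) (suc (suc (k * 2 + K * 2))) n + conv (e * 2) (k + n)

  -- This is L₂ₖ₊₂ = y L₂ₖ₊₁ + L₂ₖ at y = -1/x, arranged without subtraction. Both the shifted and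
  -- the unshifted power of C split by Cˢ⁺¹ = Cˢ + x Cˢ⁺²; the four pieces are regrouped.
  evenValue-step : ∀ k e n →
    oddValue k (suc e) (suc n) ≡ evenValue k (suc e) n + evenValue (suc k) e n
  evenValue-step k e n = begin
    shiftedConv k (suc w) n + conv (suc e * 2) (k + suc n)
      ≡⟨ ≡.cong₂ _+_ (shiftedConv-pascal k w n) (≡.cong (conv (suc e * 2)) (+-suc k n)) ⟩
    (shiftedConv k w n + x) + (y + z)
      ≡⟨ solve 4 (λ a x y z → (a :+ x) :+ (y :+ z) := (a :+ z) :+ (x :+ y))
           ≡.refl (shiftedConv k w n) x y z ⟩
    (shiftedConv k w n + z) + (x + y) ∎
    where
    open ≡-Reasoning
    open +-*-Solver
    w = suc (k * 2 + K * 2)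
    x = shiftedConv (suc k) (suc (suc w)) n
    y = conv (suc (e * 2)) (suc (k + n))
    z = conv (suc (suc e * 2)) (k + n)

  -- Likewise for L₂ₖ₊₃ = L₂ₖ₊₂ + L₂ₖ₊₁; the alternating signs put the even value alone on one side.
  oddValue-step : ∀ k e n →
    evenValue (suc k) e n ≡ oddValue k (suc e) n + oddValue (suc k) e n
  oddValue-step k e n = begin
    shiftedConv (suc k) (suc w) n + conv (suc (e * 2)) (suc (k + n))
      ≡⟨ ≡.cong (_+ conv (suc (e * 2)) (suc (k + n))) (shiftedConv-pascal (suc k) w n) ⟩
    (shiftedConv (suc k) w n + x) + (y + z)
      ≡⟨ solve 4 (λ a x y z → (a :+ x) :+ (y :+ z) := (a :+ z) :+ (x :+ y))
           ≡.refl (shiftedConv (suc k) w n) x y z ⟩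
    (shiftedConv (suc k) w n + z) + (x + y) ∎
    where
    open ≡-Reasoning
    open +-*-Solver
    w = suc (suc (k * 2 + K * 2))
    x = shiftedConv (suc (suc k)) (suc (suc w)) n
    y = conv (e * 2) (suc (k + n))
    z = conv (suc e * 2) (k + n)

-- Determinants over a commutative ring

module Determinants {c ℓ} (R : CommutativeRing c ℓ) where
  open CommutativeRing R hiding (zero) renaming (_+_ to _⊞_; _*_ to _·_; -_ to neg)
  open Exp semiring using (_^_; ^-congʳ)
  open Sum semiring using (sum; sum-cong-≋; ∑-distrib-+; sum-remove; *-distribˡ-sum)
  open CMSum *-commutativeMonoid public using ()
    renaming (sum to product; sum-remove to product-remove)
  open RingProperties ring using (-‿distribˡ-*; -‿distribʳ-*; -‿involutive; +-inverseʳ-unique; -1*x≈-x)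
  open Solver commutativeSemiring using (solve; _:=_; _:+_; _:*_)
  open SetoidReasoning setoid
  private module M = Matrices R

  -x·-y≈x·y : ∀ x y → neg x · neg y ≈ x · y
  -x·-y≈x·y x y = begin
    neg x · neg y     ≈⟨ -‿distribˡ-* x (neg y) ⟨
    neg (x · neg y)   ≈⟨ -‿cong (-‿distribʳ-* x y) ⟨
    neg (neg (x · y)) ≈⟨ -‿involutive (x · y) ⟩
    x · y             ∎

  cofactor : ∀ {n} → M.Matrix (suc n) (suc n) → Fin (suc n) → Carrier
  cofactor A j = (neg 1# ^ toℕ j) · M.det _ (M.minor zero j A)

  laplaceTerm : ∀ {n} → M.Matrix (suc n) (suc n) → Vector Carrier (suc n)
  laplaceTerm A j = (neg 1# ^ toℕ j) · (A zero j · M.det _ (M.minor zero j A))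

  det-cong : ∀ n {A B : M.Matrix n n} → (∀ i j → A i j ≈ B i j) → M.det n A ≈ M.det n B
  det-cong ℕ.zero  A≈B = refl
  det-cong (suc n) {A} {B} A≈B = sum-cong-≋ {x = laplaceTerm A} {laplaceTerm B} λ j →
    *-congˡ (*-cong (A≈B zero j) (det-cong n λ p q → A≈B (suc p) (punchIn j q)))

  -- In the Laplace term of column `p` the entry splits and the three minors agree; in any other
  -- term the entries agree and the minor splits by induction. Describing the matrices by agreement
  -- off `p` lets the hypotheses pass to minors.
  det-addColumn : ∀ n {A B D : M.Matrix n n} (p : Fin n) →
    (∀ i → D i p ≈ A i p ⊞ B i p) →
    (∀ i q → q ≢ p → A i q ≈ D i q) →
    (∀ i q → q ≢ p → B i q ≈ D i q) →
    M.det n D ≈ M.det n A ⊞ M.det n B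
  det-addColumn (suc n) {A} {B} {D} p D≈A+B A≈D B≈D =
    trans (sum-cong-≋ term) (∑-distrib-+ (laplaceTerm A) (laplaceTerm B))
    where
    term : ∀ j → laplaceTerm D j ≈ laplaceTerm A j ⊞ laplaceTerm B j
    term j with j ≟ p
    ... | yes ≡.refl = begin
      s · (D zero p · M.det n (M.minor zero p D))
        ≈⟨ *-congˡ (*-congʳ (D≈A+B zero)) ⟩
      s · ((A zero p ⊞ B zero p) · M.det n (M.minor zero p D))
        ≈⟨ solve 4 (λ s a b d → s :* ((a :+ b) :* d) := s :* (a :* d) :+ s :* (b :* d))
             refl s (A zero p) (B zero p) _ ⟩
      s · (A zero p · M.det n (M.minor zero p D)) ⊞ s · (B zero p · M.det n (M.minor zero p D))
        ≈⟨ +-cong (*-congˡ (*-congˡ (det-cong n λ i q → sym (A≈D (suc i) _ (punchInᵢ≢i p q)))))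
                  (*-congˡ (*-congˡ (det-cong n λ i q → sym (B≈D (suc i) _ (punchInᵢ≢i p q))))) ⟩
      s · (A zero p · M.det n (M.minor zero p A)) ⊞ s · (B zero p · M.det n (M.minor zero p B)) ∎
      where s = neg 1# ^ toℕ p
    ... | no j≢p = begin
      s · (D zero j · M.det n (M.minor zero j D))
        ≈⟨ *-congˡ (*-congˡ (det-addColumn n (punchOut j≢p) added (others A≈D) (others B≈D))) ⟩
      s · (D zero j · (M.det n (M.minor zero j A) ⊞ M.det n (M.minor zero j B)))
        ≈⟨ solve 4 (λ s c a b → s :* (c :* (a :+ b)) := s :* (c :* a) :+ s :* (c :* b))
             refl s (D zero j) _ _ ⟩
      s · (D zero j · M.det n (M.minor zero j A)) ⊞ s · (D zero j · M.det n (M.minor zero j B))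
        ≈⟨ +-cong (*-congˡ (*-congʳ (A≈D zero j j≢p))) (*-congˡ (*-congʳ (B≈D zero j j≢p))) ⟨
      s · (A zero j · M.det n (M.minor zero j A)) ⊞ s · (B zero j · M.det n (M.minor zero j B)) ∎
      where
      s = neg 1# ^ toℕ j
      added : ∀ i → M.minor zero j D i (punchOut j≢p) ≈
                    M.minor zero j A i (punchOut j≢p) ⊞ M.minor zero j B i (punchOut j≢p)
      added i rewrite punchIn-punchOut j≢p = D≈A+B (suc i)
      others : ∀ {X : M.Matrix (suc n) (suc n)} → (∀ i q → q ≢ p → X i q ≈ D i q) →
               ∀ i q → q ≢ punchOut j≢p → M.minor zero j X i q ≈ M.minor zero j D i q
      others X≈D i q q≢ = X≈D (suc i) _ λ eq → q≢
        (Fin.punchIn-injective j q _ (≡.trans eq (≡.sym (punchIn-punchOut j≢p))))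

  -- In each Laplace term the first-row entry supplies `v j` and the minor supplies the product of
  -- the remaining scalars.
  det-scaleColumns : ∀ n (A : M.Matrix n n) (v : Vector Carrier n) →
    M.det n (λ i j → A i j · v j) ≈ product v · M.det n A
  det-scaleColumns ℕ.zero  A v = sym (*-identityˡ 1#)
  det-scaleColumns (suc n) A v = begin
    sum (laplaceTerm Av)                   ≈⟨ sum-cong-≋ term ⟩
    sum (λ j → product v · laplaceTerm A j) ≈⟨ *-distribˡ-sum (product v) (laplaceTerm A) ⟨
    product v · M.det (suc n) A ∎
    where
    Av : M.Matrix (suc n) (suc n)
    Av i j = A i j · v j
    term : ∀ j → laplaceTerm Av j ≈ product v · laplaceTerm A j
    term j = begin
      s · ((A zero j · v j) · M.det n (λ p q → M.minor zero j A p q · v (punchIn j q)))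
        ≈⟨ *-congˡ (*-congˡ (det-scaleColumns n (M.minor zero j A) (removeAt v j))) ⟩
      s · ((A zero j · v j) · (product (removeAt v j) · M.det n (M.minor zero j A)))
        ≈⟨ solve 5 (λ s a x y d → s :* ((a :* x) :* (y :* d)) := (x :* y) :* (s :* (a :* d)))
             refl s (A zero j) (v j) _ _ ⟩
      (v j · product (removeAt v j)) · (s · (A zero j · M.det n (M.minor zero j A)))
        ≈⟨ *-congʳ (product-remove v) ⟨
      product v · (s · (A zero j · M.det n (M.minor zero j A))) ∎
      where s = neg 1# ^ toℕ j

  sum-updateAt-+ : ∀ {n} (t : Vector Carrier n) p a →
                   sum (updateAt t p (a ⊞_)) ≈ a ⊞ sum t
  sum-updateAt-+ t zero    a = +-assoc a _ _
  sum-updateAt-+ t (suc p) a = begin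
    t zero ⊞ sum (updateAt (t ∘ suc) p (a ⊞_)) ≈⟨ +-congˡ (sum-updateAt-+ (t ∘ suc) p a) ⟩
    t zero ⊞ (a ⊞ sum (t ∘ suc))
      ≈⟨ solve 3 (λ x a y → x :+ (a :+ y) := a :+ (x :+ y)) refl (t zero) a _ ⟩
    a ⊞ (t zero ⊞ sum (t ∘ suc))               ∎

  -- Merging columns p and p + 1 into their sum keeps all row sums zero, and the
  -- determinant of the merged matrix is the sum of two neighbouring minors.
  mutual
    rowSums≈0⇒det≈0 : ∀ n (A : M.Matrix (suc n) (suc n)) →
                      (∀ i → sum (A i) ≈ 0#) → M.det (suc n) A ≈ 0#
    rowSums≈0⇒det≈0 n A rows≈0 = begin
      sum (laplaceTerm A)
        ≈⟨ sum-cong-≋ (λ j → trans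
             (solve 3 (λ s a d → s :* (a :* d) := (s :* d) :* a) refl (neg 1# ^ toℕ j) (A zero j) _)
             (*-congʳ (cofactors≈ n A rows≈0 j))) ⟩
      sum (λ j → cofactor A zero · A zero j)  ≈⟨ *-distribˡ-sum (cofactor A zero) (A zero) ⟨
      cofactor A zero · sum (A zero)          ≈⟨ *-congˡ (rows≈0 zero) ⟩
      cofactor A zero · 0#                    ≈⟨ zeroʳ _ ⟩
      0#                                      ∎

    cofactors≈ : ∀ n (A : M.Matrix (suc n) (suc n)) → (∀ i → sum (A i) ≈ 0#) →
                 ∀ j → cofactor A j ≈ cofactor A zero
    cofactors≈ ℕ.zero  A rows≈0 zero = refl
    cofactors≈ (suc n) A rows≈0 =
      <-weakInduction (λ j → cofactor A j ≈ cofactor A zero) refl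
        λ p → trans (step p)
      where
      step : ∀ p → cofactor A (suc p) ≈ cofactor A (inject₁ p)
      step p = begin
        -- Passing to the next column negates both the sign and the minor, so the cofactor is
        -- unchanged.
        (neg 1# · s) · X                ≈⟨ *-congˡ X≈-Y ⟩
        (neg 1# · s) · neg Y            ≈⟨ *-congʳ (-1*x≈-x s) ⟩
        neg s · neg Y                   ≈⟨ -x·-y≈x·y s Y ⟩
        s · Y                           ≈⟨ *-congʳ (^-congʳ (neg 1#) (≡.sym (toℕ-inject₁ p))) ⟩
        (neg 1# ^ toℕ (inject₁ p)) · Y  ∎
        where
        s = neg 1# ^ toℕ p
        A′ = M.minor zero (suc p) A
        A″ = M.minor zero (inject₁ p) A
        X = M.det (suc n) A′
        Y = M.det (suc n) A″

        merged : M.Matrix (suc n) (suc n)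
        merged i = updateAt (A′ i) p (A (suc i) (suc p) ⊞_)

        merged-rows : ∀ i → sum (merged i) ≈ 0#
        merged-rows i = begin
          sum (merged i)                        ≈⟨ sum-updateAt-+ (A′ i) p _ ⟩
          A (suc i) (suc p) ⊞ sum (A′ i)        ≈⟨ sum-remove {i = suc p} (A (suc i)) ⟨
          sum (A (suc i))                       ≈⟨ rows≈0 (suc i) ⟩
          0#                                    ∎

        -- With column p deleted, `A″` holds column p + 1 at position p.
        merged-at-p : ∀ i → merged i p ≈ A″ i p ⊞ A′ i p
        merged-at-p i = reflexive (≡.trans (updateAt-updates p (A′ i))
          (≡.cong (λ q → A (suc i) q ⊞ A′ i p) (≡.sym (punchIn-inject₁-self p))))

        A′≈merged : ∀ i q → q ≢ p → A′ i q ≈ merged i q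
        A′≈merged i q q≢p = reflexive (≡.sym (updateAt-minimal q p (A′ i) q≢p))

        A″≈merged : ∀ i q → q ≢ p → A″ i q ≈ merged i q
        A″≈merged i q q≢p = trans
          (reflexive (≡.cong (A (suc i)) (≡.sym (punchIn-suc≡punchIn-inject₁ q≢p))))
          (A′≈merged i q q≢p)

        X≈-Y : X ≈ neg Y
        X≈-Y = +-inverseʳ-unique Y X (trans
          (sym (det-addColumn (suc n) p merged-at-p A″≈merged A′≈merged))
          (rowSums≈0⇒det≈0 n merged merged-rows))

  -- Scaling column j by `v j` turns the kernel condition into vanishing row sums. The product stays
  -- in the conclusion because a general ring may have zero divisors.
  kernel⇒product·det≈0 : ∀ n (A : M.Matrix (suc n) (suc n)) (v : Vector Carrier (suc n)) →
    (∀ i → sum (λ j → A i j · v j) ≈ 0#) → product v · M.det (suc n) A ≈ 0#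
  kernel⇒product·det≈0 n A v Av≈0 =
    trans (sym (det-scaleColumns (suc n) A v)) (rowSums≈0⇒det≈0 n (λ i j → A i j · v j) Av≈0)

-- Lucas polynomials applied to sequences

module AlternatingLucasSums {c ℓ} (R : CommutativeRing c ℓ) where
  open CommutativeRing R hiding (zero) renaming (_+_ to _⊞_; _*_ to _·_; -_ to neg)
  open Exp semiring using (_^_)
  open Mult semiring using (_×_; ×-homo-+; ×-congˡ)
  open Sum semiring using (sum; sum-cong-≋; sum-replicate-zero; ∑-distrib-+)
  open RingProperties ring using (-1*x≈-x; +-cancelʳ)
  open Solver commutativeSemiring using (solve; _:=_; _:+_; _:*_; con)
  open SetoidReasoning setoid

  sign : ℕ → Carrier
  sign j = neg 1# ^ j

  altTerm : (ℕ → ℕ) → (ℕ → ℕ) → ℕ → ℕ → Carrier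
  altTerm p f n j = (f (n + j) × 1#) · (sign j · (p j × 1#))

  -- Applies the polynomial with coefficients p, evaluated at minus the shift
  -- operator, to the sequence f.
  altSum : ℕ → (ℕ → ℕ) → (ℕ → ℕ) → ℕ → Carrier
  altSum N p f n = sum {N} λ j → altTerm p f n (toℕ j)

  s+[-1·s]≈0 : ∀ s → s ⊞ neg 1# · s ≈ 0#
  s+[-1·s]≈0 s = trans (+-congˡ (-1*x≈-x s)) (-‿inverseʳ s)

  -- Converts the subtraction-free recursions in ℕ into signed ones: consecutive signs cancel the
  -- common part `a`.
  opposite-signs-cancel : ∀ s a z →
    s · (a × 1#) ⊞ (neg 1# · s) · ((a + z) × 1#) ≈ (neg 1# · s) · (z × 1#)
  opposite-signs-cancel s a z = begin
    s · (a × 1#) ⊞ t · ((a + z) × 1#)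
      ≈⟨ +-congˡ (*-congˡ (×-homo-+ 1# a z)) ⟩
    s · (a × 1#) ⊞ t · (a × 1# ⊞ z × 1#)
      ≈⟨ solve 4 (λ s t a z → s :* a :+ t :* (a :+ z) := (s :+ t) :* a :+ t :* z)
           refl s t (a × 1#) (z × 1#) ⟩
    (s ⊞ t) · (a × 1#) ⊞ t · (z × 1#)
      ≈⟨ +-congʳ (trans (*-congʳ (s+[-1·s]≈0 s)) (zeroˡ _)) ⟩
    0# ⊞ t · (z × 1#)
      ≈⟨ +-identityˡ _ ⟩
    t · (z × 1#) ∎
    where t = neg 1# · s

  -- The recursion L₂ₖ₊₂ = y L₂ₖ₊₁ + L₂ₖ with y acting as minus the shift. The factor y raises the
  -- index by one, so the odd sum starts at `suc n` and has one term fewer.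
  altSum-evenLucas : ∀ N k f n →
    altSum (suc N) (evenLucas (suc k)) f n ⊞ altSum N (oddLucas k) f (suc n) ≈
    altSum (suc N) (evenLucas k) f n
  altSum-evenLucas N k f n = begin
    (h ⊞ sum new) ⊞ sum odd  ≈⟨ +-assoc h _ _ ⟩
    h ⊞ (sum new ⊞ sum odd)  ≈⟨ +-congˡ (∑-distrib-+ new odd) ⟨
    h ⊞ sum (λ j → new j ⊞ odd j)  ≈⟨ +-congˡ (sum-cong-≋ {N} (λ j → term (toℕ j))) ⟩
    h ⊞ sum old              ∎
    where
    h = altTerm (evenLucas k) f n 0
    new old odd : Vector Carrier N
    new j = altTerm (evenLucas (suc k)) f n (suc (toℕ j))
    old j = altTerm (evenLucas k) f n (suc (toℕ j))
    odd j = altTerm (oddLucas k) f (suc n) (toℕ j)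

    term : ∀ j → altTerm (evenLucas (suc k)) f n (suc j) ⊞ altTerm (oddLucas k) f (suc n) j ≈
                 altTerm (evenLucas k) f n (suc j)
    term j = begin
      x · (t · ((p + q) × 1#)) ⊞ (f (suc n + j) × 1#) · (s · (p × 1#))
        ≈⟨ +-congˡ (*-congʳ (×-congˡ (≡.cong f (≡.sym (+-suc n j))))) ⟩
      x · (t · ((p + q) × 1#)) ⊞ x · (s · (p × 1#))
        ≈⟨ solve 3 (λ x y z → x :* y :+ x :* z := x :* (z :+ y)) refl x _ _ ⟩
      x · (s · (p × 1#) ⊞ t · ((p + q) × 1#))
        ≈⟨ *-congˡ (opposite-signs-cancel s p q) ⟩
      x · (t · (q × 1#)) ∎
      where
      x = f (n + suc j) × 1#
      s = sign j
      t = sign (suc j)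
      p = oddLucas k j
      q = evenLucas k (suc j)

  altSum-oddLucas : ∀ N k f n →
    altSum N (oddLucas (suc k)) f n ≈
    altSum N (oddLucas k) f n ⊞ altSum N (evenLucas (suc k)) f n
  altSum-oddLucas N k f n = trans (sum-cong-≋ {N} (λ j → term (toℕ j)))
    (∑-distrib-+ {N} (altTerm (oddLucas k) f n ∘ toℕ) (altTerm (evenLucas (suc k)) f n ∘ toℕ))
    where
    term : ∀ j → altTerm (oddLucas (suc k)) f n j ≈
                 altTerm (oddLucas k) f n j ⊞ altTerm (evenLucas (suc k)) f n j
    term j = trans (*-congˡ (*-congˡ (×-homo-+ 1# (oddLucas k j) (evenLucas (suc k) j))))
      (solve 4 (λ x s p q → x :* (s :* (p :+ q)) := x :* (s :* p) :+ x :* (s :* q))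
         refl (f (n + j) × 1#) (sign j) _ _)

  altSum-constant : ∀ N p f n → (∀ j → p (suc j) ≡ 0) →
    altSum (suc N) p f n ≈ (f n × 1#) · (p 0 × 1#)
  altSum-constant N p f n p≡0 = begin
    altTerm p f n 0 ⊞ sum {N} (λ j → altTerm p f n (suc (toℕ j)))
      ≈⟨ +-cong (*-cong (×-congˡ (≡.cong f (ℕₚ.+-identityʳ n))) (*-identityˡ _))
                (trans (sum-cong-≋ {N} (λ j → vanish (toℕ j))) (sum-replicate-zero N)) ⟩
    (f n × 1#) · (p 0 × 1#) ⊞ 0#
      ≈⟨ +-identityʳ _ ⟩
    (f n × 1#) · (p 0 × 1#) ∎
    where
    vanish : ∀ j → altTerm p f n (suc j) ≈ 0#
    vanish j rewrite p≡0 j = trans (*-congˡ (zeroʳ _)) (zeroʳ _)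

  module _ (K : ℕ) where
    open LucasValues K

    mutual
      -- Mutual induction along the Lucas recursions. The polynomials with index k have degree k, so
      -- `k < N` keeps all their coefficients in the sum.
      altSum-evenLucas-conv : ∀ k e → k + e ≡ K → ∀ N n → k < N →
        altSum N (evenLucas k) f n ≈ sign k · (evenValue k e n × 1#)
      altSum-evenLucas-conv ℕ.zero e ≡.refl (suc N) n k<N = begin
        altSum (suc N) (evenLucas 0) f n      ≈⟨ altSum-constant N (evenLucas 0) f n (λ _ → ≡.refl) ⟩
        (f n × 1#) · (1# ⊞ (1# ⊞ 0#))
          ≈⟨ solve 1 (λ x → x :* (con 1 :+ (con 1 :+ con 0)) := con 1 :* (x :+ x)) refl (f n × 1#) ⟩
        1# · (f n × 1# ⊞ f n × 1#)            ≈⟨ *-congˡ (×-homo-+ 1# (f n) (f n)) ⟨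
        1# · ((f n + f n) × 1#)               ∎
      altSum-evenLucas-conv (suc k) e k+e≡K (suc N) n (s≤s k<N) =
        +-cancelʳ (s · (b × 1#)) _ _ (begin
          altSum (suc N) (evenLucas (suc k)) f n ⊞ s · (b × 1#)
            ≈⟨ +-congˡ (altSum-oddLucas-conv k (suc e) k+1+e≡K N (suc n) k<N) ⟨
          altSum (suc N) (evenLucas (suc k)) f n ⊞ altSum N (oddLucas k) f (suc n)
            ≈⟨ altSum-evenLucas N k f n ⟩
          altSum (suc N) (evenLucas k) f n
            ≈⟨ altSum-evenLucas-conv k (suc e) k+1+e≡K (suc N) n (m≤n⇒m≤1+n k<N) ⟩
          s · (a × 1#)
            ≈⟨ +-identityʳ _ ⟨
          -- Zero is inserted as (s - s) `z` to complete `a` to `a + z`, which is `b` by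
          -- `evenValue-step`.
          s · (a × 1#) ⊞ 0#
            ≈⟨ +-congˡ (trans (*-congʳ (s+[-1·s]≈0 s)) (zeroˡ (z × 1#))) ⟨
          s · (a × 1#) ⊞ (s ⊞ neg 1# · s) · (z × 1#)
            ≈⟨ solve 4 (λ s t a z → s :* a :+ (s :+ t) :* z := t :* z :+ s :* (a :+ z))
                 refl s (neg 1# · s) (a × 1#) (z × 1#) ⟩
          (neg 1# · s) · (z × 1#) ⊞ s · (a × 1# ⊞ z × 1#)
            ≈⟨ +-congˡ (*-congˡ (trans (×-congˡ (evenValue-step k e n)) (×-homo-+ 1# a z))) ⟨
          (neg 1# · s) · (z × 1#) ⊞ s · (b × 1#) ∎)
        where
        k+1+e≡K = ≡.trans (+-suc k e) k+e≡K
        s = sign k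
        a = evenValue k (suc e) n
        b = oddValue k (suc e) (suc n)
        z = evenValue (suc k) e n

      altSum-oddLucas-conv : ∀ k e → k + e ≡ K → ∀ N n → k < N →
        altSum N (oddLucas k) f n ≈ sign k · (oddValue k e n × 1#)
      altSum-oddLucas-conv ℕ.zero e ≡.refl (suc N) n k<N = begin
        altSum (suc N) (oddLucas 0) f n  ≈⟨ altSum-constant N (oddLucas 0) f n (λ _ → ≡.refl) ⟩
        (f n × 1#) · (1# ⊞ 0#)           ≈⟨ solve 1 (λ x → x :* (con 1 :+ con 0) := con 1 :* x) refl _ ⟩
        1# · (f n × 1#)                  ≈⟨ *-congˡ (×-congˡ (f≡oddValue n)) ⟩
        1# · (oddValue 0 e n × 1#)       ∎
        where
        -- At k = 0 the two parts of the odd value are those of C²ᴷ⁺¹ = C²ᴷ + x C²ᴷ⁺².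
        f≡oddValue : ∀ n → f n ≡ oddValue 0 e n
        f≡oddValue n = ≡.trans (shiftedConv-pascal 0 (e * 2) n) (ℕₚ.+-comm (conv (e * 2) n) _)
      altSum-oddLucas-conv (suc k) e k+e≡K N n k<N = begin
        altSum N (oddLucas (suc k)) f n
          ≈⟨ altSum-oddLucas N k f n ⟩
        altSum N (oddLucas k) f n ⊞ altSum N (evenLucas (suc k)) f n
          ≈⟨ +-cong (altSum-oddLucas-conv k (suc e) (≡.trans (+-suc k e) k+e≡K) N n (<-trans (n<1+n k) k<N))
                    (altSum-evenLucas-conv (suc k) e k+e≡K N n k<N) ⟩
        s · (a × 1#) ⊞ (neg 1# · s) · (evenValue (suc k) e n × 1#)
          ≈⟨ +-congˡ (*-congˡ (×-congˡ (oddValue-step k e n))) ⟩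
        s · (a × 1#) ⊞ (neg 1# · s) · ((a + z) × 1#)
          ≈⟨ opposite-signs-cancel s a z ⟩
        (neg 1# · s) · (z × 1#) ∎
        where
        s = sign k
        a = oddValue k (suc e) n
        z = oddValue (suc k) e n

    -- At k = K the value is the coefficient of xⁿ in xᴷ⁺¹ C⁴ᴷ⁺², zero since n ≤ K, plus that of
    -- xᴷ⁺ⁿ in C⁰ = 1, zero since K ≥ 1.
    altSum-oddLucas≈0 : ∀ n → 1 ≤ K → n ≤ K → altSum (suc K) (oddLucas K) f n ≈ 0#
    altSum-oddLucas≈0 n 1≤K n≤K = begin
      altSum (suc K) (oddLucas K) f n   ≈⟨ altSum-oddLucas-conv K 0 (ℕₚ.+-identityʳ K) (suc K) n ≤-refl ⟩
      sign K · (oddValue K 0 n × 1#)    ≈⟨ *-congˡ (×-congˡ value≡0) ⟩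
      sign K · 0#                       ≈⟨ zeroʳ _ ⟩
      0#                                ∎
      where
      conv-zero : ∀ {m} → 1 ≤ m → conv 0 m ≡ 0
      conv-zero (s≤s _) = ≡.refl
      value≡0 : oddValue K 0 n ≡ 0
      value≡0 = ≡.cong₂ _+_ (shiftedConv≡0 (suc (suc (K * 2 + K * 2))) (s≤s n≤K))
                            (conv-zero (≤-trans 1≤K (m≤m+n K n)))

-- Specialisation to the rationals

module ℚDet = Determinants ℚₚ.+-*-commutativeRing
module ℚSum = AlternatingLucasSums ℚₚ.+-*-commutativeRing
open Mult (CommutativeRing.semiring ℚₚ.+-*-commutativeRing) using (_×_)

/1-suc : ∀ n → ℚ.1ℚ ℚ.+ ℤ.+ n ℚ./ 1 ≡ ℤ.+ suc n ℚ./ 1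
/1-suc n = ℚₚ.toℚᵘ-injective (begin
  ℚ.toℚᵘ (ℚ.1ℚ ℚ.+ ℤ.+ n ℚ./ 1)
    ≈⟨ ℚₚ.toℚᵘ-homo-+ ℚ.1ℚ (ℤ.+ n ℚ./ 1) ⟩
  ℚᵘ.1ℚᵘ ℚᵘ.+ ℚ.toℚᵘ (ℤ.+ n ℚ./ 1)
    ≈⟨ ℚᵘₚ.+-congʳ ℚᵘ.1ℚᵘ (ℚₚ.toℚᵘ-fromℚᵘ (ℚᵘ.mkℚᵘ (ℤ.+ n) 0)) ⟩
  ℚᵘ.1ℚᵘ ℚᵘ.+ ℚᵘ.mkℚᵘ (ℤ.+ n) 0
    ≈⟨ ℚᵘ.*≡* (≡.cong (λ x → (ℤ.1ℤ ℤ.+ x) ℤ.* ℤ.1ℤ) (ℤ.*-identityʳ (ℤ.+ n))) ⟩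
  ℚᵘ.mkℚᵘ (ℤ.+ suc n) 0
    ≈⟨ ℚₚ.toℚᵘ-fromℚᵘ (ℚᵘ.mkℚᵘ (ℤ.+ suc n) 0) ⟨
  ℚ.toℚᵘ (ℤ.+ suc n ℚ./ 1) ∎)
  where open SetoidReasoning ℚᵘₚ.≃-setoid

×1≡/1 : ∀ n → n × ℚ.1ℚ ≡ ℤ.+ n ℚ./ 1
×1≡/1 ℕ.zero  = ≡.refl
×1≡/1 (suc n) = ≡.trans (≡.cong (ℚ.1ℚ ℚ.+_) (×1≡/1 n)) (/1-suc n)

×1≢0 : ∀ {n} → 1 ≤ n → n × ℚ.1ℚ ≢ 0ℚ
×1≢0 {suc n} _ n≡0
  with ℚᵘ.*≡* () ← ℚₚ.fromℚᵘ-injective {ℚᵘ.mkℚᵘ (ℤ.+ suc n) 0} {ℚᵘ.0ℚᵘ}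
                     (≡.trans (≡.sym (×1≡/1 (suc n))) n≡0)

-- Passing to unnormalised fractions reduces the equation to cross-multiplication, without reference
-- to greatest common divisors.
/-*-/1 : ∀ r m b c .{{_ : NonZero m}} → m * c ≡ r * b →
         (ℤ.+ r ℚ./ m) ℚ.* (ℤ.+ b ℚ./ 1) ≡ ℤ.+ c ℚ./ 1
/-*-/1 r m@(suc m-1) b c mc≡rb = ℚₚ.toℚᵘ-injective (begin
  ℚ.toℚᵘ ((ℤ.+ r ℚ./ m) ℚ.* (ℤ.+ b ℚ./ 1))
    ≈⟨ ℚₚ.toℚᵘ-homo-* (ℤ.+ r ℚ./ m) (ℤ.+ b ℚ./ 1) ⟩
  ℚ.toℚᵘ (ℤ.+ r ℚ./ m) ℚᵘ.* ℚ.toℚᵘ (ℤ.+ b ℚ./ 1)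
    ≈⟨ ℚᵘₚ.*-cong (ℚₚ.toℚᵘ-fromℚᵘ (ℚᵘ.mkℚᵘ (ℤ.+ r) m-1))
                  (ℚₚ.toℚᵘ-fromℚᵘ (ℚᵘ.mkℚᵘ (ℤ.+ b) 0)) ⟩
  ℚᵘ.mkℚᵘ (ℤ.+ r) m-1 ℚᵘ.* ℚᵘ.mkℚᵘ (ℤ.+ b) 0
    ≈⟨ ℚᵘ.*≡* cross ⟩
  ℚᵘ.mkℚᵘ (ℤ.+ c) 0
    ≈⟨ ℚₚ.toℚᵘ-fromℚᵘ (ℚᵘ.mkℚᵘ (ℤ.+ c) 0) ⟨
  ℚ.toℚᵘ (ℤ.+ c ℚ./ 1) ∎)
  where
  cross : (ℤ.+ r ℤ.* ℤ.+ b) ℤ.* ℤ.1ℤ ≡ ℤ.+ c ℤ.* ℤ.+ (m * 1)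
  cross = ≡-begin
    (ℤ.+ r ℤ.* ℤ.+ b) ℤ.* ℤ.1ℤ  ≡⟨ ℤ.*-identityʳ _ ⟩
    ℤ.+ r ℤ.* ℤ.+ b             ≡⟨ ℤ.pos-* r b ⟨
    ℤ.+ (r * b)                 ≡⟨ ≡.cong ℤ.+_ mc≡rb ⟨
    ℤ.+ (m * c)                 ≡⟨ ≡.cong ℤ.+_ (ℕₚ.*-comm m c) ⟩
    ℤ.+ (c * m)                 ≡⟨ ℤ.pos-* c m ⟩
    ℤ.+ c ℤ.* ℤ.+ m             ≡⟨ ≡.cong (λ x → ℤ.+ c ℤ.* ℤ.+ x) (ℕₚ.*-identityʳ m) ⟨
    ℤ.+ c ℤ.* ℤ.+ (m * 1)       ≡-∎
    where open ≡-Reasoning renaming (begin_ to ≡-begin_; _∎ to _≡-∎)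
  open SetoidReasoning ℚᵘₚ.≃-setoid

catalan≡conv : ∀ r n .{{_ : NonZero r}} → catalan r n ≡ conv r n × ℚ.1ℚ
catalan≡conv r n = ≡.trans
  (/-*-/1 r (2 * n + r) ((2 * n + r) C n) (conv r n) {{2n+r≢0 n r}} (conv-formula n r))
  (≡.sym (×1≡/1 (conv r n)))

p*q≡0∧p≢0⇒q≡0 : ∀ {p q} → p ℚ.* q ≡ 0ℚ → p ≢ 0ℚ → q ≡ 0ℚ
p*q≡0∧p≢0⇒q≡0 {p} {q} pq≡0 p≢0 = begin
  q                       ≡⟨ ℚₚ.*-identityˡ q ⟨
  ℚ.1ℚ ℚ.* q              ≡⟨ ≡.cong (ℚ._* q) (ℚₚ.*-inverseˡ p) ⟨
  (ℚ.1/ p) ℚ.* p ℚ.* q    ≡⟨ ℚₚ.*-assoc (ℚ.1/ p) p q ⟩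
  (ℚ.1/ p) ℚ.* (p ℚ.* q)  ≡⟨ ≡.cong ((ℚ.1/ p) ℚ.*_) pq≡0 ⟩
  (ℚ.1/ p) ℚ.* 0ℚ         ≡⟨ ℚₚ.*-zeroʳ (ℚ.1/ p) ⟩
  0ℚ                      ∎
  where
  open ≡-Reasoning
  instance _ = ℚ.≢-nonZero p≢0

*-≢0 : ∀ {p q} → p ≢ 0ℚ → q ≢ 0ℚ → p ℚ.* q ≢ 0ℚ
*-≢0 p≢0 q≢0 pq≡0 = q≢0 (p*q≡0∧p≢0⇒q≡0 pq≡0 p≢0)

product≢0 : ∀ {n} (v : Vector ℚ n) → (∀ i → v i ≢ 0ℚ) → ℚDet.product v ≢ 0ℚ
product≢0 {ℕ.zero} v v≢0 = λ ()
product≢0 {suc n}  v v≢0 = *-≢0 (v≢0 zero) (product≢0 (v ∘ suc) (v≢0 ∘ suc))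

sign≢0 : ∀ j → ℚSum.sign j ≢ 0ℚ
sign≢0 ℕ.zero  = λ ()
sign≢0 (suc j) = *-≢0 {ℚ.- ℚ.1ℚ} (λ ()) (sign≢0 j)

theorem7p1 : ∀ (k : ℕ) → 1 ≤ k →
    det (suc k) (λ i j → catalan (suc (2 * k)) (toℕ i + toℕ j)) ≡ 0ℚ
theorem7p1 k 1≤k = p*q≡0∧p≢0⇒q≡0
  (≡.trans (≡.cong (ℚDet.product v ℚ.*_) (ℚDet.det-cong (suc k) entry))
           (ℚDet.kernel⇒product·det≈0 k A v Av≡0))
  (product≢0 v v≢0)
  where
  A : Matrix (suc k) (suc k)
  A i j = conv (suc (k * 2)) (toℕ i + toℕ j) × ℚ.1ℚ

  -- The coefficients of L₂ₖ₊₁ at y = -1/x: the kernel vector.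
  v : Vector ℚ (suc k)
  v j = ℚSum.sign (toℕ j) ℚ.* (oddLucas k (toℕ j) × ℚ.1ℚ)

  entry : ∀ (i j : Fin (suc k)) → catalan (suc (2 * k)) (toℕ i + toℕ j) ≡ A i j
  entry i j = ≡.trans (catalan≡conv (suc (2 * k)) (toℕ i + toℕ j))
    (≡.cong (λ x → conv (suc x) (toℕ i + toℕ j) × ℚ.1ℚ) (ℕₚ.*-comm 2 k))

  -- Evaluated at n = i, `altSum` unfolds to row i of `A` times `v`.
  Av≡0 : ∀ (i : Fin (suc k)) → ℚSum.altSum (suc k) (oddLucas k) (conv (suc (k * 2))) (toℕ i) ≡ 0ℚ
  Av≡0 i = ℚSum.altSum-oddLucas≈0 k (toℕ i) 1≤k (Fin.toℕ≤pred[n] i)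

  v≢0 : ∀ j → v j ≢ 0ℚ
  v≢0 j = *-≢0 (sign≢0 (toℕ j)) (×1≢0 (oddLucas-positive (Fin.toℕ≤pred[n] j)))
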